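{- (M-INF) The following type is inhabited: $$\sum_{u:M}\ \prod_{z:M}\ \Bigl(z\in u\;\simeq\;\bigl(Z\,z\;+\;\sum_{y:M}(y\in u\;\wedge\;S\,y\,z)\bigr)\Bigr),$$ where, for $y,z:M$, $$S\,y\,z:=\prod_{x:M}\bigl(x\in z\;\simeq\;(x\in y\;+\;x=_M y)\bigr),\qquad Z\,z:=\prod_{x:M}\neg(x\in z).$$
   Context: The setting is Martin-Löf (homotopy/univalent) type theory with the Univalence Axiom (hence function extensionality); $A:\mathrm{Set}$ means "$A$ is a type" (not necessarily a 0-type), $A\simeq B$ is the type of equivalences as in the Homotopy Type Theory book, $+$ is the disjoint sum of types, $\wedge$ is the product type $\times$ (propositions-as-types), and $\neg A$ is $A\to 0$ with $0$ the empty type. $U:\mathrm{Set}$ is a univalent universe with decoding function $T:U\to\mathrm{Set}$; univalent means that for $a,b:U$ the canonical map $\mathrm{Id}_U\,a\,b\to (T\,a\simeq T\,b)$ is an equivalence. $U$ is assumed closed under $+$, $\Sigma$-, $\Pi$- and identity types, and to contain codes for the empty type $0$, the unit type $1$ and the type $\mathbb{N}$ of natural numbers. $M := W_{a:U}\,T\,a$ is the W-type with canonical elements $\sup\,a\,f$, where $a:U$ and $f:T\,a\to M$. The relation $=_M\,:M\to M\to\mathrm{Set}$ is defined by recursion: $$(\sup\,a\,f)=_M(\sup\,b\,g)\;:=\;\sum_{\alpha:T a\simeq T b}\ \prod_{x:T a}\ (f\,x)=_M\bigl(g\,(\alpha\,x)\bigr).$$ The relation $\in\,:M\to M\to\mathrm{Set}$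 is defined by $$x\in(\sup\,b\,g)\;:=\;\sum_{i:T b}\ x=_M(g\,i).$$ -}

{-# OPTIONS --without-K #-}

module Defs where

open import Level using (Level; suc; _⊔_)
open import Data.Container.Core using (_▷_)
open import Data.Empty using (⊥)
open import Data.Nat.Base using (ℕ)
open import Data.Product.Base using (Σ-syntax; _,_)
open import Data.Sum.Base using (_⊎_)
open import Data.Unit.Base using (⊤)
open import Data.W using (W; sup)
open import Function.Base using (id)
open import Function.Properties.Inverse.HalfAdjointEquivalence using (_≃_)
open import Relation.Binary.PropositionalEquality.Core using (_≡_; refl; cong)
open import Relation.Nullary.Negation.Core using (¬_)

private
  variable
    a b ℓ : Level

-- The coherent notion is needed: _≃_ is the type of half adjoint
-- equivalences, and IsEquiv f is the tuple of its fields other than `to`.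

IsEquiv : {A : Set a} {B : Set b} → (A → B) → Set (a ⊔ b)
IsEquiv {A = A} {B = B} f =
  Σ[ g ∈ (B → A) ]
  Σ[ η ∈ (∀ x → g (f x) ≡ x) ]
  Σ[ ε ∈ (∀ y → f (g y) ≡ y) ]
  (∀ x → cong f (η x) ≡ ε (f x))

idEquiv : (A : Set a) → A ≃ A
idEquiv A = record
  { to               = id
  ; from             = id
  ; left-inverse-of  = λ _ → refl
  ; right-inverse-of = λ _ → refl
  ; left-right       = λ _ → refl
  }

idToEquiv : {U : Set a} (T : U → Set b) (x y : U) → x ≡ y → T x ≃ T y
idToEquiv T x .x refl = idEquiv (T x)

Univalent : {U : Set a} → (U → Set b) → Set (a ⊔ b)
Univalent T = ∀ x y → IsEquiv (idToEquiv T x y)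

UnivalenceAxiom : (ℓ : Level) → Set (suc ℓ)
UnivalenceAxiom ℓ = Univalent {U = Set ℓ} id

-- Closure is up to equivalence, since a judgemental equality
-- T (code A) = A cannot be assumed inside the theory.

HasCode : {U : Set a} → (U → Set b) → Set ℓ → Set (a ⊔ b ⊔ ℓ)
HasCode {U = U} T A = Σ[ c ∈ U ] (T c ≃ A)

record UnivalentUniverse (a b : Level) : Set (suc (a ⊔ b)) where
  field
    U          : Set a
    T          : U → Set b
    univalent  : Univalent T
    +-closed   : (x y : U) → HasCode T (T x ⊎ T y)
    Σ-closed   : (x : U) (y : T x → U) → HasCode T (Σ[ i ∈ T x ] T (y i))
    Π-closed   : (x : U) (y : T x → U) → HasCode T ((i : T x) → T (y i))
    ≡-closed   : (x : U) (i j : T x) → HasCode T (i ≡ j)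
    ⊥-code     : HasCode T ⊥
    ⊤-code     : HasCode T ⊤
    ℕ-code     : HasCode T ℕ

module Multisets (𝒰 : UnivalentUniverse a b) where

  open UnivalentUniverse 𝒰 using (U; T)

  M : Set (a ⊔ b)
  M = W (U ▷ T)

  infix 4 _=M_ _∈_

  _=M_ : M → M → Set b
  sup (x , f) =M sup (y , g) =
    Σ[ α ∈ T x ≃ T y ] ((i : T x) → f i =M g (_≃_.to α i))

  _∈_ : M → M → Set b
  x ∈ sup (y , g) = Σ[ i ∈ T y ] (x =M g i)

  S : M → M → Set (a ⊔ b)
  S y z = (x : M) → (x ∈ z) ≃ ((x ∈ y) ⊎ (x =M y))

  Z : M → Set (a ⊔ b)
  Z z = (x : M) → ¬ (x ∈ z)

{-# OPTIONS --without-K #-}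
module Submission where

-- The witness u is the multiset of finite von Neumann ordinals, with index
-- type ℕ and with elements numeral n, where numeral 0 is empty and
-- numeral (n + 1) is numeral n with numeral n itself added as one further
-- element.
--
-- The main ingredient is multiset extensionality: z =M w is equivalent to
-- ∀ x → (x ∈ z) ≃ (x ∈ w). It characterises both kinds of numeral among all
-- multisets: z =M numeral 0 is equivalent to Z z, and z =M numeral (n + 1) is
-- equivalent to S (numeral n) z (=Mempty↔Z and =Madjoin↔S). Splitting the index
-- n : ℕ into zero and successor then gives
--
--   z ∈ u  ↔  Σ n, z =M numeral n
--          ↔  Z z ⊎ Σ n, S (numeral n) z
--          ↔  Z z ⊎ Σ y, y ∈ u × S y z,
--
-- where the last step contracts y along the identification of y with
-- numeral n.
--
-- Extensionality rests on two facts. First, =M is the identity type of M: it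
-- is reflexive, and the pairs (w , p) with p : z =M w form a contractible
-- type, by induction on z, univalence of the universe and function
-- extensionality (=M-view). This permits path induction along =M. Secondly,
-- x ∈ sup (b , g) is the homotopy fibre of g at x, so a family of
-- equivalences of fibres is the same as an equivalence of the index types
-- that commutes with the element maps; the family is recovered from its
-- values at the pairs (i , =M-refl).
--
-- Since multisets may have repeated elements, all these are equivalences of
-- types and not just bi-implications, so being a half adjoint equivalence
-- must be a property. By univalence it is enough to check this for the
-- identity map, where it follows from function extensionality.

open import Defs
open import Axiom.Extensionality.Propositional using (Extensionality)
open import Data.Empty using (⊥-elim)
open import Data.Nat.Base using (ℕ; zero; suc)
open import Data.Product.Base using (Σ; Σ-syntax; _×_; _,_; proj₁; proj₂)
open import Data.Product.Function.Dependent.Propositional using () renaming (cong to Σ-cong)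
open import Data.Sum.Base using (_⊎_; inj₁; inj₂; [_,_])
open import Data.Sum.Function.Propositional using (_⊎-↔_)
open import Data.Unit.Base using (tt)
open import Data.W using (sup)
open import Function.Base using (id; _∘_; const)
open import Function.Bundles using (Inverse; _↔_; mk↔ₛ′)
open import Function.Properties.Inverse using (↔-refl; ↔-sym; ↔-trans)
open import Function.Properties.Inverse.HalfAdjointEquivalence using (_≃_; ↔⇒≃; ≃⇒↔)
open import Function.Related.TypeIsomorphisms using (Σ-distribʳ-⊎)
open import Level using (Level; _⊔_; Lift; lift; lower)
open import Relation.Binary.PropositionalEquality
  using (_≡_; refl; sym; trans; cong; cong-app; subst; trans-symˡ)
open import Relation.Nullary.Irrelevant using (Irrelevant)
open import Relation.Nullary.Negation.Core using (¬_)

private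
  variable
    a b c p : Level
    A B : Set a

-- Contractibility and induction on equivalences

-- Contractible types, with a chosen centre.
IsContr : Set a → Set a
IsContr A = Σ[ x ∈ A ] (∀ y → x ≡ y)

isContr⇒irrelevant : IsContr A → Irrelevant A
isContr⇒irrelevant (_ , h) x y = trans (sym (h x)) (h y)

-- In a univalent family, to construct an element of P over every equivalence
-- out of T x it is enough to do so over the identity of T x.
≃-induction : {U : Set a} {T : U → Set b} → Univalent T → {x : U}
              (P : ∀ y → T x ≃ T y → Set p) →
              P x (idEquiv (T x)) → ∀ y e → P y e
≃-induction {T = T} univ {x} P P-id y e with univ x y
... | from , _ , ε , _ = subst (P y) (ε e) (along (from e))
  where
  along : ∀ {y} (q : x ≡ y) → P y (idToEquiv T x y q)
  along refl = P-id

Σ-reindex : {A : Set a} {B : Set b} {P : B → Set p} (e : A ≃ B) →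
            Σ A (P ∘ _≃_.to e) ↔ Σ B P
Σ-reindex e = Σ-cong (≃⇒↔ e) ↔-refl

Σ-suc : {P : ℕ → Set p} → Σ ℕ P ↔ (P zero ⊎ Σ ℕ (P ∘ suc))
Σ-suc = mk↔ₛ′
  (λ { (zero , x) → inj₁ x ; (suc n , x) → inj₂ (n , x) })
  [ zero ,_ , (λ { (n , x) → suc n , x }) ]
  (λ { (inj₁ _) → refl ; (inj₂ _) → refl })
  (λ { (zero , _) → refl ; (suc _ , _) → refl })

module _ (ua : ∀ ℓ → UnivalenceAxiom ℓ) where

  -- Function extensionality from univalence

  -- Postcomposition with an equivalence has contractible fibres, because this
  -- is evident for the identity.
  ∘-fibre-contractible : {A B : Set a} (e : A ≃ B) {X : Set b} (k : X → B) →
                         IsContr (Σ[ h ∈ (X → A) ] (_≃_.to e ∘ h ≡ k))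
  ∘-fibre-contractible {a = a} e {X} k =
    ≃-induction (ua a) (λ B e → (k : X → B) → IsContr (Σ[ h ∈ _ ] (_≃_.to e ∘ h ≡ k)))
      (λ k → (k , refl) , λ { (_ , refl) → refl }) _ e k

  -- Sections of P form a retract of the type of lifts of the identity along
  -- the projection Σ A P → A, which is an equivalence. Lift p puts A at the
  -- level of Σ A P.
  Π-contractible : {A : Set a} {P : A → Set p} →
                   (∀ x → IsContr (P x)) → IsContr (∀ x → P x)
  Π-contractible {a = a} {p = p} {A = A} {P = P} c =
    section (proj₁ lifts) , λ φ → cong section (proj₂ lifts ((λ x → x , φ x) , refl))
    where
    projection : Σ A P ≃ Lift p A
    projection = ↔⇒≃ (mk↔ₛ′
      (λ (x , _) → lift x)
      (λ (lift x) → x , proj₁ (c x))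
      (λ _ → refl)
      (λ (x , y) → cong (x ,_) (proj₂ (c x) y)))

    lifts : IsContr (Σ[ h ∈ (A → Σ A P) ] ((λ x → lift (proj₁ (h x))) ≡ lift))
    lifts = ∘-fibre-contractible projection lift

    section : Σ[ h ∈ (A → Σ A P) ] ((λ x → lift (proj₁ (h x))) ≡ lift) → ∀ x → P x
    section (h , q) x = subst P (cong lower (cong-app q x)) (proj₂ (h x))

  -- f and g with f≗g are two sections of the family of contractible types
  -- Σ y, f x ≡ y.
  funext : Extensionality a b
  funext {B = B} {f} {g} f≗g =
    cong (λ φ x → proj₁ (φ x))
      (isContr⇒irrelevant
        (Π-contractible {P = λ x → Σ[ y ∈ B x ] (f x ≡ y)}
          (λ x → (f x , refl) , λ { (_ , refl) → refl }))
        (λ x → f x , refl) (λ x → g x , f≗g x))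

  Π-cong-↔ : {A : Set a} {P : A → Set b} {Q : A → Set c} →
             (∀ x → P x ↔ Q x) → (∀ x → P x) ↔ (∀ x → Q x)
  Π-cong-↔ i = mk↔ₛ′
    (λ φ x → Inverse.to (i x) (φ x)) (λ ψ x → Inverse.from (i x) (ψ x))
    (λ ψ → funext λ x → Inverse.strictlyInverseˡ (i x) (ψ x))
    (λ φ → funext λ x → Inverse.strictlyInverseʳ (i x) (φ x))

  -- Being an equivalence is a property

  -- IsEquiv id is a retract of a product, over x, of types of triples
  -- (y , η , ε); each of these contracts onto y = x, η = refl, ε = refl.
  isEquiv-id-irrelevant : Irrelevant (IsEquiv (id {A = A}))
  isEquiv-id-irrelevant {A = A} e e′ =
    cong collect (isContr⇒irrelevant (Π-contractible contr) (spread e) (spread e′))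
    where
    Triple : A → Set _
    Triple x = Σ[ y ∈ A ] Σ[ η ∈ y ≡ x ] Σ[ ε ∈ y ≡ x ] (cong id η ≡ ε)

    contr : ∀ x → IsContr (Triple x)
    contr x = (x , refl , refl , refl) , λ { (_ , refl , _ , refl) → refl }

    spread : IsEquiv id → ∀ x → Triple x
    spread (g , η , ε , τ) x = g x , η x , ε x , τ x

    collect : (∀ x → Triple x) → IsEquiv id
    collect φ = (λ x → proj₁ (φ x)) , (λ x → proj₁ (proj₂ (φ x)))
              , (λ x → proj₁ (proj₂ (proj₂ (φ x)))) , (λ x → proj₂ (proj₂ (proj₂ (φ x))))

  isEquiv-irrelevant : {A B : Set a} (e : A ≃ B) → Irrelevant (IsEquiv (_≃_.to e))
  isEquiv-irrelevant {a = a} =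
    ≃-induction (ua a) (λ _ e → Irrelevant (IsEquiv (_≃_.to e))) isEquiv-id-irrelevant _

  mk≃ : (f : A → B) → IsEquiv f → A ≃ B
  mk≃ f (g , η , ε , τ) = record
    { to = f ; from = g ; left-inverse-of = η ; right-inverse-of = ε ; left-right = τ }

  isEquiv : (e : A ≃ B) → IsEquiv (_≃_.to e)
  isEquiv e = from , left-inverse-of , right-inverse-of , left-right
    where open _≃_ e

  ≃-≡ : {A B : Set a} {e e′ : A ≃ B} → (∀ x → _≃_.to e x ≡ _≃_.to e′ x) → e ≡ e′
  ≃-≡ {A = A} {B} {e} {e′} h = go (funext h) (isEquiv e′)
    where
    go : ∀ {f} → _≃_.to e ≡ f → (q : IsEquiv f) → e ≡ mk≃ f q
    go refl q = cong (mk≃ _) (isEquiv-irrelevant e (isEquiv e) q)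

  ≃-congʳ : {A B C : Set a} → B ≃ C → (A ≃ B) ↔ (A ≃ C)
  ≃-congʳ {a = a} {A = A} {B} =
    ≃-induction (ua a) (λ C _ → (A ≃ B) ↔ (A ≃ C)) ↔-refl _

  -- Both sides are mere propositions, since a map into an empty type is determined.
  ≃-empty : {A B : Set a} → ¬ B → (A ≃ B) ↔ (¬ A)
  ≃-empty ¬B = mk↔ₛ′
    (λ e x → ¬B (_≃_.to e x))
    (λ ¬A → ↔⇒≃ (mk↔ₛ′ (⊥-elim ∘ ¬A) (⊥-elim ∘ ¬B) (⊥-elim ∘ ¬B) (⊥-elim ∘ ¬A)))
    (λ ¬A → funext λ x → ⊥-elim (¬A x))
    (λ e → ≃-≡ λ x → ⊥-elim (¬B (_≃_.to e x)))

  module _ (𝒰 : UnivalentUniverse a b) where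

    open UnivalentUniverse 𝒰
    open Multisets 𝒰

    -- The relation =M as identity type

    =M-refl : ∀ {z} → z =M z
    =M-refl {sup (x , f)} = idEquiv (T x) , λ _ → =M-refl

    -- View p says that p is reflexivity. Matching on =M-view z p for p : z =M w
    -- identifies z with w and p with =M-refl, whichever of the two ends is a
    -- variable; it plays the part of path induction.
    data View {z : M} : ∀ {w} → z =M w → Set (a ⊔ b) where
      refl : View =M-refl

    -- Univalence moves α to the identity; the elements (g i , h i) of the
    -- types Σ w, f i =M w are then moved to (f i , =M-refl) all at once by
    -- function extensionality.
    abstract
      =M-view : ∀ z {w} (p : z =M w) → View p
      =M-view (sup (x , f)) {sup (y , g)} (α , h) =
        ≃-induction univalent
          (λ y α → (g : T y → M) (h : ∀ i → f i =M g (_≃_.to α i)) →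
                   View {sup (x , f)} {sup (y , g)} (α , h))
          at-id y α g h
        where
        pointed-≡ : ∀ {i w} (p : f i =M w) → View p →
                    _≡_ {A = Σ[ w ∈ M ] (f i =M w)} (f i , =M-refl) (w , p)
        pointed-≡ _ refl = refl

        at-id : ∀ g (h : ∀ i → f i =M g i) →
                View {sup (x , f)} {sup (x , g)} (idEquiv (T x) , h)
        at-id g h =
          subst
            (λ (φ : ∀ i → Σ[ w ∈ M ] (f i =M w)) →
              View {sup (x , f)} {sup (x , proj₁ ∘ φ)} (idEquiv (T x) , proj₂ ∘ φ))
            (funext {B = λ i → Σ[ w ∈ M ] (f i =M w)}
              λ i → pointed-≡ (h i) (=M-view (f i) (h i)))
            refl

    =M↔≡ : ∀ z w → (z =M w) ↔ (z ≡ w)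
    =M↔≡ z w = mk↔ₛ′ ⇒ ⇐ ⇒∘⇐ ⇐∘⇒
      where
      raw : ∀ {w} → z =M w → z ≡ w
      raw p with =M-view z p
      ... | refl = refl

      -- The correction by raw =M-refl makes ⇒ send =M-refl to refl.
      ⇒ : ∀ {w} → z =M w → z ≡ w
      ⇒ p = trans (sym (raw =M-refl)) (raw p)

      ⇐ : ∀ {w} → z ≡ w → z =M w
      ⇐ refl = =M-refl

      ⇒∘⇐ : ∀ {w} (q : z ≡ w) → ⇒ (⇐ q) ≡ q
      ⇒∘⇐ refl = trans-symˡ (raw =M-refl)

      ⇐∘⇒ : ∀ {w} (p : z =M w) → ⇐ (⇒ p) ≡ p
      ⇐∘⇒ p = lemma p (=M-view z p)
        where
        lemma : ∀ {w} (p : z =M w) → View p → ⇐ (⇒ p) ≡ p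
        lemma _ refl = cong ⇐ (trans-symˡ (raw =M-refl))

    -- Multiset extensionality

    =M⇒≃ : ∀ z w → z =M w → ∀ x → (x ∈ z) ≃ (x ∈ w)
    =M⇒≃ z _ p with =M-view z p
    ... | refl = λ x → idEquiv (x ∈ z)

    open _≃_ using (to; from; left-inverse-of; right-inverse-of)

    -- The action on indices of a map φ between memberships, through the
    -- canonical point (i , =M-refl) of the fibre over f i.
    onIndex : ∀ {x y} {f : T x → M} {g : T y → M} →
              (∀ v → v ∈ sup (x , f) → v ∈ sup (y , g)) → T x → T y
    onIndex {f = f} φ i = proj₁ (φ (f i) (i , =M-refl))

    -- All points of a fibre are canonical up to =M, so the action on indices
    -- does not depend on the point of the fibre.
    onIndex-fibre : ∀ {x y} {f : T x → M} {g : T y → M}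
                    (φ : ∀ v → v ∈ sup (x , f) → v ∈ sup (y , g)) {v} (k : v ∈ sup (x , f)) →
                    proj₁ (φ v k) ≡ onIndex {f = f} {g} φ (proj₁ k)
    onIndex-fibre φ {v} (i , p) with =M-view v p
    ... | refl = refl

    -- The inverse is the action of from ∘ e. Each composite evaluates the second
    -- map at a canonical point instead of at the value of the first map;
    -- onIndex-fibre corrects this.
    abstract
      onIndex-isEquiv : ∀ {x y} {f : T x → M} {g : T y → M}
                        (e : ∀ v → (v ∈ sup (x , f)) ≃ (v ∈ sup (y , g))) →
                        IsEquiv (onIndex {f = f} {g} (to ∘ e))
      onIndex-isEquiv {f = f} {g} e = isEquiv (↔⇒≃ (mk↔ₛ′
        (onIndex {f = f} {g} (to ∘ e)) (onIndex {f = g} {f} (from ∘ e))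
        (λ j → trans
          (sym (onIndex-fibre (to ∘ e) (from (e (g j)) (j , =M-refl))))
          (cong proj₁ (right-inverse-of (e (g j)) (j , =M-refl))))
        (λ i → trans
          (sym (onIndex-fibre (from ∘ e) (to (e (f i)) (i , =M-refl))))
          (cong proj₁ (left-inverse-of (e (f i)) (i , =M-refl))))))

    ≃⇒=M : ∀ z w → (∀ x → (x ∈ z) ≃ (x ∈ w)) → z =M w
    ≃⇒=M (sup (x , f)) (sup (y , g)) e =
      mk≃ (onIndex {f = f} {g} (to ∘ e)) (onIndex-isEquiv e)
      , λ i → proj₂ (to (e (f i)) (i , =M-refl))

    -- The equivalence of memberships given by p = (α , h) sends the canonical
    -- point over f i to (α i , h i).
    =M⇒≃-canonical : ∀ {x f y g} (p : sup (x , f) =M sup (y , g)) i →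
                     to (=M⇒≃ (sup (x , f)) (sup (y , g)) p (f i)) (i , =M-refl)
                       ≡ (to (proj₁ p) i , proj₂ p i)
    =M⇒≃-canonical {x} {f} {y} {g} p i with =M-view (sup (x , f)) {sup (y , g)} p
    ... | refl = refl

    -- Families of equivalences of memberships that agree at the canonical
    -- points are equal.
    canonical-≡ : ∀ {x f} w (e e′ : ∀ v → (v ∈ sup (x , f)) ≃ (v ∈ w)) →
                  (∀ i → to (e (f i)) (i , =M-refl) ≡ to (e′ (f i)) (i , =M-refl)) → e ≡ e′
    canonical-≡ {x} {f} w e e′ h = funext λ v → ≃-≡ (at v)
      where
      at : ∀ v (k : v ∈ sup (x , f)) → to (e v) k ≡ to (e′ v) k
      at v (i , p) with =M-view v p
      ... | refl = h i

    extensionality : ∀ z w → (z =M w) ↔ (∀ x → (x ∈ z) ≃ (x ∈ w))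
    extensionality z w = mk↔ₛ′ (=M⇒≃ z w) (≃⇒=M z w) (⇒∘⇐ z w) (⇐∘⇒ z)
      where
      ⇒∘⇐ : ∀ z w (e : ∀ x → (x ∈ z) ≃ (x ∈ w)) → =M⇒≃ z w (≃⇒=M z w e) ≡ e
      ⇒∘⇐ z@(sup (x , f)) w@(sup (y , g)) e =
        canonical-≡ w (=M⇒≃ z w (≃⇒=M z w e)) e (=M⇒≃-canonical {f = f} {g = g} (≃⇒=M z w e))

      -- The recovered identification is the identity on indices and differs
      -- from =M-refl only in the proof that this is an equivalence.
      ≃⇒=M-id : ∀ z → ≃⇒=M z z (λ x → idEquiv (x ∈ z)) ≡ =M-refl
      ≃⇒=M-id z@(sup (x , f)) = cong (λ q → mk≃ id q , λ _ → =M-refl)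
        (isEquiv-id-irrelevant (onIndex-isEquiv {f = f} {f} (λ x → idEquiv (x ∈ z)))
                               (isEquiv (idEquiv (T x))))

      ⇐∘⇒ : ∀ z {w} (p : z =M w) → ≃⇒=M z w (=M⇒≃ z w p) ≡ p
      ⇐∘⇒ z p with =M-view z p
      ... | refl = ≃⇒=M-id z

    -- The empty multiset and the adjunction of an element

    empty : M
    empty = sup (proj₁ ⊥-code , ⊥-elim ∘ to (proj₂ ⊥-code))

    -- The multiset y with y itself as one further element.
    adjoin : M → M
    adjoin y@(sup (x , f)) = sup (proj₁ code , [ f , const y ] ∘ to (proj₂ code))
      where code = +-closed x (proj₁ ⊤-code)

    ∈-adjoin : ∀ y x → (x ∈ adjoin y) ↔ ((x ∈ y) ⊎ (x =M y))
    ∈-adjoin y@(sup (c , f)) x =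
      ↔-trans (Σ-reindex {P = λ k → x =M [ f , const y ] k} (proj₂ (+-closed c (proj₁ ⊤-code))))
      (↔-trans Σ-distribʳ-⊎
      (↔-refl ⊎-↔ ↔-trans (Σ-reindex {P = λ _ → x =M y} (proj₂ ⊤-code))
                          (mk↔ₛ′ proj₂ (tt ,_) (λ _ → refl) (λ _ → refl))))

    =Mempty↔Z : ∀ z → (z =M empty) ↔ Z z
    =Mempty↔Z z = ↔-trans (extensionality z empty)
      (Π-cong-↔ λ x → ≃-empty λ (i , _) → to (proj₂ ⊥-code) i)

    =Madjoin↔S : ∀ y z → (z =M adjoin y) ↔ S y z
    =Madjoin↔S y z = ↔-trans (extensionality z (adjoin y))
      (Π-cong-↔ λ x → ≃-congʳ (↔⇒≃ (∈-adjoin y x)))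

    -- The multiset of finite von Neumann ordinals

    -- The n-th finite von Neumann ordinal.
    numeral : ℕ → M
    numeral zero    = empty
    numeral (suc n) = adjoin (numeral n)

    -- The multiset of all numerals, with each n : ℕ as one index.
    ω : M
    ω = sup (proj₁ ℕ-code , numeral ∘ to (proj₂ ℕ-code))

    ∈-ω : ∀ z → (z ∈ ω) ↔ (Σ[ n ∈ ℕ ] (z =M numeral n))
    ∈-ω z = Σ-reindex {P = λ n → z =M numeral n} (proj₂ ℕ-code)

    -- A variable y that is identified with some g i can be eliminated.
    Σ-contract : {I : Set c} (g : I → M) (P : M → Set p) →
                 (Σ[ y ∈ M ] ((Σ[ i ∈ I ] (y =M g i)) × P y)) ↔ (Σ[ i ∈ I ] P (g i))
    Σ-contract g P = ↔-trans
      (Σ-cong ↔-refl (Σ-cong (Σ-cong ↔-refl (=M↔≡ _ _)) ↔-refl))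
      (mk↔ₛ′ (λ { (_ , (i , refl) , q) → i , q })
             (λ (i , q) → g i , (i , refl) , q)
             (λ _ → refl)
             (λ { (_ , (_ , refl) , _) → refl }))

    ω-spec : ∀ z → (z ∈ ω) ↔ (Z z ⊎ (Σ[ y ∈ M ] ((y ∈ ω) × S y z)))
    ω-spec z =
      ↔-trans (∈-ω z)
      (↔-trans Σ-suc
      (=Mempty↔Z z ⊎-↔
        ↔-trans (Σ-cong ↔-refl (=Madjoin↔S _ z))
        (↔-sym (↔-trans (Σ-cong ↔-refl (Σ-cong (∈-ω _) ↔-refl))
                        (Σ-contract numeral (λ y → S y z))))))

proposition4 : (∀ ℓ → UnivalenceAxiom ℓ) →
    {a b : Level} (𝒰 : UnivalentUniverse a b) →
    let open Multisets 𝒰 in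
    Σ[ u ∈ M ] ((z : M) → (z ∈ u) ≃ (Z z ⊎ (Σ[ y ∈ M ] ((y ∈ u) × S y z))))
proposition4 ua 𝒰 = ω ua 𝒰 , λ z → ↔⇒≃ (ω-spec ua 𝒰 z)
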